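{- Let $m\ge1$ and let $B=(b_0,b_1,\dots,b_{N-1})$ be a singleton board fitting inside $\Delta_{N,m}$ (so $b_j\le jm$ for all $0\le j\le N-1$). Then for every integer $0\le k<N$, $$r_{k,m}(B)=\sum_{i=0}^k(-1)^i\,m^{k-i}\,S(N-i,N-k)\,e_i\bigl(-b_0,\,m-b_1,\,\dots,\,(N-1)m-b_{N-1}\bigr).$$
   Context: Fix an integer $m\ge 1$. A Ferrers board $B=(b_0,\dots,b_{N-1})$ with $0\le b_0\le b_1\le\dots\le b_{N-1}$ consists of bottom-justified columns of these heights, left to right (some initial heights may be zero). Level $p$ ($p\ge1$) consists of rows $(p-1)m+1,\dots,pm$, counted from the bottom. An $m$-level rook placement of $k$ rooks on $B$ is a set of $k$ cells of $B$, no two in the same column or the same level; $r_{k,m}(B)$ is the number of these. A column terminates in level $p$ if $p$ is the largest level it meets; $B$ is a singleton board if it is a Ferrers board and for each $p$ at most one column terminating in level $p$ has height not divisible by $m$. $\Delta_{N,m}$ is the Ferrers board $(0,m,2m,\dots,(N-1)m)$; $B$ fits inside $\Delta_{N,m}$ if, with lower right cells aligned, $B\subseteq\Delta_{N,m}$. $S(n,d)$ is the Stirling number of the second kind (number of partitions of an $n$-set into $d$ blocks), and $e_d(x_1,\dots,x_n)$ is the elementary symmetric polynomial of degree $d$. -}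

module Defs where

open import Data.Bool.Properties using () renaming (_≟_ to _≟ᵇ_)
open import Data.Fin using (Fin; toℕ) renaming (_≤_ to _≤ᶠ_)
open import Data.Fin.Properties using () renaming (_≟_ to _≟ᶠ_)
open import Data.Fin.Subset using (Subset; inside; outside; ⊤; ⋃; _∩_; Nonempty; Empty)
open import Data.Fin.Subset.Properties using (nonempty?)
open import Data.Integer using (ℤ; 0ℤ; 1ℤ) renaming (_+_ to _+ℤ_; _*_ to _*ℤ_)
open import Data.List using (List; []; _∷_; [_]; _++_; map; foldr; filter; length; concatMap; allFin; upTo)
open import Data.List.Relation.Unary.All using (All; all?)
open import Data.List.Relation.Unary.AllPairs using (AllPairs; allPairs?)
open import Data.Nat using (ℕ; zero; suc; _*_; _∸_; _/_; _≤_; NonZero) renaming (_≟_ to _≟ⁿ_)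
open import Data.Nat.Divisibility using (_∤_)
open import Data.Product using (_×_; _,_; ∃-syntax)
open import Data.Vec using ([]; _∷_)
open import Data.Vec.Functional using (Vector)
open import Data.Vec.Properties using (≡-dec)
open import Relation.Binary.PropositionalEquality using (_≡_; _≢_)
open import Relation.Nullary using (Dec; ¬?; _×-dec_)

-- The k-element sublists, selected by position.  When the list has no
-- repetitions these are its k-element subsets, each listed exactly once.
choose : ∀ {a} {A : Set a} → ℕ → List A → List (List A)
choose zero    _        = [ [] ]
choose (suc k) []       = []
choose (suc k) (x ∷ xs) = map (x ∷_) (choose k xs) ++ choose (suc k) xs

Board : ℕ → Set
Board N = Vector ℕ N

IsFerrers : ∀ {N} → Board N → Set
IsFerrers B = ∀ {i j} → i ≤ᶠ j → B i ≤ B j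

-- Rows are numbered from 1, so row r lies in level p = level m r exactly
-- when (p - 1)m + 1 ≤ r ≤ pm.
level : (m : ℕ) .{{_ : NonZero m}} → ℕ → ℕ
level m r = suc ((r ∸ 1) / m)

-- A cell is a pair (column , row).
Cell : ℕ → Set
Cell N = Fin N × ℕ

cells : ∀ {N} → Board N → List (Cell N)
cells {N} B = concatMap (λ j → map (λ i → j , suc i) (upTo (B j))) (allFin N)

NonAttacking : (m : ℕ) .{{_ : NonZero m}} → ∀ {N} → Cell N → Cell N → Set
NonAttacking m (j , r) (j′ , r′) = j ≢ j′ × level m r ≢ level m r′

nonAttacking? : (m : ℕ) .{{_ : NonZero m}} → ∀ {N} (c c′ : Cell N) → Dec (NonAttacking m c c′)
nonAttacking? m (j , r) (j′ , r′) = ¬? (j ≟ᶠ j′) ×-dec ¬? (level m r ≟ⁿ level m r′)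

placements : (m : ℕ) .{{_ : NonZero m}} → ℕ → ∀ {N} → Board N → List (List (Cell N))
placements m k B = filter (allPairs? (nonAttacking? m)) (choose k (cells B))

rookNumber : (m : ℕ) .{{_ : NonZero m}} → ℕ → ∀ {N} → Board N → ℕ
rookNumber m k B = length (placements m k B)

-- The column is represented by its height h.
Meets : (m : ℕ) .{{_ : NonZero m}} → (h p : ℕ) → Set
Meets m h p = ∃[ r ] (1 ≤ r × r ≤ h × level m r ≡ p)

TerminatesIn : (m : ℕ) .{{_ : NonZero m}} → (h p : ℕ) → Set
TerminatesIn m h p = Meets m h p × (∀ q → Meets m h q → q ≤ p)

record IsSingleton (m : ℕ) .{{_ : NonZero m}} {N : ℕ} (B : Board N) : Set where
  field
    ferrers   : IsFerrers B
    singleton : ∀ p i j →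
                TerminatesIn m (B i) p → m ∤ B i →
                TerminatesIn m (B j) p → m ∤ B j →
                i ≡ j

Δ : (N m : ℕ) → Board N
Δ N m j = toℕ j * m

-- Both boards have N columns, so aligning the lower right cells aligns
-- column j with column j.
FitsInside : ∀ {N} → Board N → Board N → Set
FitsInside B C = ∀ j → B j ≤ C j

subsets : ∀ n → List (Subset n)
subsets zero    = [ [] ]
subsets (suc n) = map (outside ∷_) (subsets n) ++ map (inside ∷_) (subsets n)

IsPartition : ∀ {n} → List (Subset n) → Set
IsPartition P = All Nonempty P × AllPairs (λ p q → Empty (p ∩ q)) P × ⋃ P ≡ ⊤

isPartition? : ∀ {n} (P : List (Subset n)) → Dec (IsPartition P)
isPartition? P =
  all? nonempty? P ×-dec
  allPairs? (λ p q → ¬? (nonempty? (p ∩ q))) P ×-dec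
  ≡-dec _≟ᵇ_ (⋃ P) ⊤

stirling₂ : ℕ → ℕ → ℕ
stirling₂ n d = length (filter isPartition? (choose d (subsets n)))

sumℤ productℤ : List ℤ → ℤ
sumℤ     = foldr _+ℤ_ 0ℤ
productℤ = foldr _*ℤ_ 1ℤ

-- Elementary symmetric polynomial of degree d, evaluated at the xs.
elementary : ℕ → List ℤ → ℤ
elementary d xs = sumℤ (map productℤ (choose d xs))

{-# OPTIONS --safe #-}
module Submission where

-- Write c_j = j m - b_j.  Both sides satisfy the same recurrence when the last
-- column, of height h, is removed from a board with N + 1 columns:
--   r(N + 1, k + 1) = r(N, k + 1) + (h - k m) r(N, k).
-- For the rook numbers, the singleton condition forces every level meeting an
-- earlier column to be full in the last one, so k rooks placed in the earlier
-- columns block exactly k m cells there.  For the right-hand side, it follows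
-- from e_{i+1}(c, c_N) = e_{i+1}(c) + c_N e_i(c) and
-- S(n + 1, d + 1) = S(n, d) + (d + 1) S(n, d + 1).
-- The Stirling recurrence is obtained by counting F(n, d), the families of d
-- disjoint nonempty subsets of an n-set: adjoining the complement of the union
-- together with a new point gives S(n + 1, d + 1) = F(n, d).

open import Defs
open import Data.Bool using (if_then_else_; true; false)
open import Data.Bool.Properties using () renaming (_≟_ to _≟ᵇ_)
open import Data.Fin using (Fin; zero; suc; toℕ; inject₁; fromℕ)
open import Data.Fin.Properties using (fromℕ≢inject₁; inject₁-injective; toℕ-inject₁; toℕ-fromℕ; inject₁ℕ≤)
open import Data.Fin.Subset using (Subset; inside; outside; ⊤; ⊥; ∁; ⋃; _∈_; _⊆_; _∩_; _∪_; Nonempty; Empty)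
open import Data.Fin.Subset.Properties using (nonempty?; Empty-unique; ∉⊥; ∪-comm; ∪-isCommutativeMonoid; ∩-comm; ∩-idem; p∪∁p≡⊤; x∈p∩q⁺; x∈p∩q⁻; x∈p∪q⁺; x∈p∪q⁻; x∈p⇒x∉∁p; x∉p⇒x∈∁p; ∈⊤; ⊆-antisym)
open import Data.List using (List; []; _∷_; [_]; _++_; map; filter; length; tabulate; upTo; applyUpTo; allFin; concatMap)
open import Data.List.Properties using (map-++; map-∘; map-cong; map-upTo; map-tabulate; map-concatMap; concatMap-++; concatMap-map; concatMap-cong; ++-identityʳ; length-map; length-tabulate; tabulate-cong)
open import Data.List.Relation.Binary.Permutation.Propositional using (_↭_; prep; swap; ↭-sym; ↭-refl; ↭⇒↭ₛ)
open import Data.List.Relation.Binary.Permutation.Propositional.Properties using (All-resp-↭; shift)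
import Data.List.Relation.Binary.Permutation.Setoid.Properties as ↭ₛ
open import Data.List.Relation.Unary.All as All using (All; []; _∷_; all?)
import Data.List.Relation.Unary.All.Properties as All
open import Data.List.Relation.Unary.AllPairs as AllPairs using (AllPairs; []; _∷_; allPairs?)
import Data.List.Relation.Unary.AllPairs.Properties as AllPairs
open import Data.Nat using (ℕ; zero; suc; NonZero; _≤_; _<_; _∸_; _/_; _≟_; z≤n; s≤s)
import Data.Nat as ℕ
open import Data.Nat.DivMod using (m<n*o⇒m/o<n; m*n/n≡m; /-monoˡ-≤; +-distrib-/-∣ˡ; m<n⇒m/n≡0)
open import Data.Nat.Divisibility using (_∤_; divides; n∣m*n)
open import Data.Nat.ListAction using (sum)
open import Data.Nat.ListAction.Properties using (sum-++)
import Data.Nat.Properties as ℕ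
open import Data.Product using (_×_; _,_; proj₁; ∃-syntax)
open import Data.Sum using (_⊎_; inj₁; inj₂; [_,_]′)
open import Data.Vec using ([]; _∷_; here; there)
open import Data.Vec.Properties using (≡-dec; ∷-injectiveˡ; ∷-injectiveʳ)
open import Function using (_∘_; id)
open import Relation.Binary using (Symmetric)
open import Relation.Binary.Definitions using (_Respects_)
open import Relation.Binary.PropositionalEquality using (_≡_; _≢_; refl; sym; trans; cong; cong₂; subst; setoid; ≢-sym; module ≡-Reasoning)
open import Relation.Nullary using (Dec; yes; no; does; ¬_; ¬?; _×-dec_; contradiction)
open import Relation.Nullary.Decidable using (dec-true; dec-false; decidable-stable)
open import Relation.Unary using (Decidable)

module _ where
  open import Data.Nat using (_+_; _*_)
  open import Data.Nat.Properties using (+-assoc; +-comm; +-identityʳ; +-monoʳ-≤; *-identityˡ; *-identityʳ; *-zeroʳ; *-distribˡ-+; *-monoˡ-≤; +-commutativeSemigroup; m+[n∸m]≡n; m≤m+n; m+n≡0⇒m≡0; ∸-monoˡ-≤; suc-injective; ≤-refl; ≤-reflexive; ≤-trans; ≤-antisym; <-irrefl; <-≤-trans; ≤-<-trans; <⇒≤; <⇒≢; ≮⇒≥; m<n⇒m<1+n; n<1+n)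
  open import Data.Nat.Tactic.RingSolver using (solve-∀)
  open import Algebra.Properties.CommutativeSemigroup +-commutativeSemigroup using (interchange)

  private variable
    A C : Set

  -- Finite sums over lists.

  ∑ : List A → (A → ℕ) → ℕ
  ∑ xs f = sum (map f xs)

  ∑-cong : ∀ (xs : List A) {f g : A → ℕ} → (∀ x → f x ≡ g x) → ∑ xs f ≡ ∑ xs g
  ∑-cong xs f≗g = cong sum (map-cong f≗g xs)

  ∑-++ : ∀ xs ys (f : A → ℕ) → ∑ (xs ++ ys) f ≡ ∑ xs f + ∑ ys f
  ∑-++ xs ys f = trans (cong sum (map-++ f xs ys)) (sum-++ (map f xs) (map f ys))

  ∑-map : ∀ (g : C → A) xs (f : A → ℕ) → ∑ (map g xs) f ≡ ∑ xs (f ∘ g)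
  ∑-map g xs f = cong sum (sym (map-∘ xs))

  ∑-0 : (xs : List A) → ∑ xs (λ _ → 0) ≡ 0
  ∑-0 []       = refl
  ∑-0 (x ∷ xs) = ∑-0 xs

  ∑-+ : ∀ (xs : List A) f g → ∑ xs (λ x → f x + g x) ≡ ∑ xs f + ∑ xs g
  ∑-+ []       f g = refl
  ∑-+ (x ∷ xs) f g = trans (cong (f x + g x +_) (∑-+ xs f g)) (interchange (f x) (g x) (∑ xs f) (∑ xs g))

  ∑-*ˡ : ∀ (xs : List A) c f → ∑ xs (λ x → c * f x) ≡ c * ∑ xs f
  ∑-*ˡ []       c f = sym (*-zeroʳ c)
  ∑-*ˡ (x ∷ xs) c f = trans (cong (c * f x +_) (∑-*ˡ xs c f)) (sym (*-distribˡ-+ c (f x) (∑ xs f)))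

  ∑-swap : ∀ (xs : List A) (ys : List C) (f : A → C → ℕ) →
           ∑ xs (λ x → ∑ ys (λ y → f x y)) ≡ ∑ ys (λ y → ∑ xs (λ x → f x y))
  ∑-swap []       ys f = sym (∑-0 ys)
  ∑-swap (x ∷ xs) ys f = trans (cong (∑ ys (f x) +_) (∑-swap xs ys f)) (sym (∑-+ ys (f x) _))

  -- Indicators of decidable propositions.

  𝟙 : {P : Set} → Dec P → ℕ
  𝟙 P? = if does P? then 1 else 0

  module _ {P : Set} (P? : Dec P) where

    𝟙-yes : P → 𝟙 P? ≡ 1
    𝟙-yes p = cong (if_then 1 else 0) (dec-true P? p)

    𝟙-no : ¬ P → 𝟙 P? ≡ 0
    𝟙-no ¬p = cong (if_then 1 else 0) (dec-false P? ¬p)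

    𝟙-× : {Q : Set} (Q? : Dec Q) → 𝟙 (P? ×-dec Q?) ≡ 𝟙 P? * 𝟙 Q?
    𝟙-× Q? with does P?
    ... | true  = sym (+-identityʳ (𝟙 Q?))
    ... | false = refl

    𝟙-⇔ : {Q : Set} (Q? : Dec Q) → (P → Q) → (Q → P) → 𝟙 P? ≡ 𝟙 Q?
    𝟙-⇔ (yes q) f g = 𝟙-yes (g q)
    𝟙-⇔ (no ¬q) f g = 𝟙-no (¬q ∘ f)

  length-filter-∑ : {P : A → Set} (P? : Decidable P) (xs : List A) →
                  length (filter P? xs) ≡ ∑ xs (𝟙 ∘ P?)
  length-filter-∑ P? []       = refl
  length-filter-∑ P? (x ∷ xs) with does (P? x)
  ... | true  = cong suc (length-filter-∑ P? xs)
  ... | false = length-filter-∑ P? xs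

  -- Weighted sums over k-element sublists.

  ∑-choose-∷ : ∀ k (x : A) xs (W : List A → ℕ) →
               ∑ (choose (suc k) (x ∷ xs)) W ≡ ∑ (choose k xs) (W ∘ (x ∷_)) + ∑ (choose (suc k) xs) W
  ∑-choose-∷ k x xs W =
    trans (∑-++ (map (x ∷_) (choose k xs)) _ W)
          (cong (_+ ∑ (choose (suc k) xs) W) (∑-map (x ∷_) (choose k xs) W))

  ∑-choose-map : ∀ (g : C → A) k xs (W : List A → ℕ) →
                 ∑ (choose k (map g xs)) W ≡ ∑ (choose k xs) (W ∘ map g)
  ∑-choose-map g zero    xs       W = refl
  ∑-choose-map g (suc k) []       W = refl
  ∑-choose-map g (suc k) (x ∷ xs) W = begin
    ∑ (choose (suc k) (map g (x ∷ xs))) W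
      ≡⟨ ∑-choose-∷ k (g x) (map g xs) W ⟩
    ∑ (choose k (map g xs)) (W ∘ (g x ∷_)) + ∑ (choose (suc k) (map g xs)) W
      ≡⟨ cong₂ _+_ (∑-choose-map g k xs _) (∑-choose-map g (suc k) xs W) ⟩
    ∑ (choose k xs) (W ∘ (g x ∷_) ∘ map g) + ∑ (choose (suc k) xs) (W ∘ map g)
      ≡⟨ ∑-choose-∷ k x xs (W ∘ map g) ⟨
    ∑ (choose (suc k) (x ∷ xs)) (W ∘ map g) ∎
    where open ≡-Reasoning

  -- The weights have to be compared only on lists that `choose k xs` can produce. Both the length
  -- and the property `P` of the entries are needed to count the rows blocked by k rooks.
  ∑-choose-cong : ∀ {P : A → Set} k {xs} {V W : List A → ℕ} → All P xs →
                  (∀ s → All P s → length s ≡ k → V s ≡ W s) →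
                  ∑ (choose k xs) V ≡ ∑ (choose k xs) W
  ∑-choose-cong zero    Pxs h = cong (_+ 0) (h [] [] refl)
  ∑-choose-cong (suc k) []  h = refl
  ∑-choose-cong (suc k) {x ∷ xs} {V} {W} (px ∷ pxs) h = begin
    ∑ (choose (suc k) (x ∷ xs)) V
      ≡⟨ ∑-choose-∷ k x xs V ⟩
    ∑ (choose k xs) (V ∘ (x ∷_)) + ∑ (choose (suc k) xs) V
      ≡⟨ cong₂ _+_ (∑-choose-cong k pxs (λ s ps eq → h (x ∷ s) (px ∷ ps) (cong suc eq)))
                   (∑-choose-cong (suc k) pxs h) ⟩
    ∑ (choose k xs) (W ∘ (x ∷_)) + ∑ (choose (suc k) xs) W
      ≡⟨ ∑-choose-∷ k x xs W ⟨
    ∑ (choose (suc k) (x ∷ xs)) W ∎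
    where open ≡-Reasoning

  -- Any two entries of `ys` conflict, so the first two entries of a sublist of length at least two
  -- already make its weight vanish.
  ∑-choose-clique : ∀ {P : A → Set} k {ys} {W : List A → ℕ} → All P ys →
                    (∀ x y s → P x → P y → W (x ∷ y ∷ s) ≡ 0) →
                    ∑ (choose (suc (suc k)) ys) W ≡ 0
  ∑-choose-clique k [] h = refl
  ∑-choose-clique k {y ∷ ys} {W} (py ∷ pys) h = begin
    ∑ (choose (suc (suc k)) (y ∷ ys)) W
      ≡⟨ ∑-choose-∷ (suc k) y ys W ⟩
    ∑ (choose (suc k) ys) (W ∘ (y ∷_)) + ∑ (choose (suc (suc k)) ys) W
      ≡⟨ cong₂ _+_ (trans (∑-choose-cong (suc k) pys vanish) (∑-0 (choose (suc k) ys)))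
                   (∑-choose-clique k pys h) ⟩
    0 ∎
    where
    open ≡-Reasoning
    vanish : ∀ s → All _ s → length s ≡ suc k → W (y ∷ s) ≡ 0
    vanish (x ∷ s) (px ∷ _) _ = h y x s py px

  ∑-choose-1 : ∀ (xs : List A) (W : List A → ℕ) → ∑ (choose 1 xs) W ≡ ∑ xs (W ∘ [_])
  ∑-choose-1 []       W = refl
  ∑-choose-1 (x ∷ xs) W = cong (W [ x ] +_) (∑-choose-1 xs W)

  -- `choose` keeps the order of the list. Invariance allows a distinguished entry to be moved to
  -- the front, so that sublists behave like sets.
  PermutationInvariant : (List A → ℕ) → Set
  PermutationInvariant W = ∀ {s t} → s ↭ t → W s ≡ W t

  -- A sublist of nonzero weight has at most one entry from ys.
  ∑-choose-++ : ∀ {P : A → Set} k xs {ys} (W : List A → ℕ) → All P ys → PermutationInvariant W →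
                (∀ x y s → P x → P y → W (x ∷ y ∷ s) ≡ 0) →
                ∑ (choose (suc k) (xs ++ ys)) W ≡
                ∑ (choose (suc k) xs) W + ∑ ys (λ y → ∑ (choose k xs) (λ s → W (y ∷ s)))
  ∑-choose-++ zero [] {ys} W Pys W-inv h =
    trans (∑-choose-1 ys W) (∑-cong ys (λ y → sym (+-identityʳ (W [ y ]))))
  ∑-choose-++ (suc k) [] {ys} W Pys W-inv h = trans (∑-choose-clique k Pys h) (sym (∑-0 ys))
  ∑-choose-++ zero (x ∷ xs) {ys} W Pys W-inv h = begin
    ∑ (choose 1 (x ∷ xs ++ ys)) W
      ≡⟨ cong (W [ x ] +_) (∑-choose-++ zero xs W Pys W-inv h) ⟩
    W [ x ] + (∑ (choose 1 xs) W + rest)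
      ≡⟨ +-assoc (W [ x ]) _ rest ⟨
    W [ x ] + ∑ (choose 1 xs) W + rest ∎
    where
    open ≡-Reasoning
    rest = ∑ ys (λ y → W [ y ] + 0)
  ∑-choose-++ {P = P} (suc k) (x ∷ xs) {ys} W Pys W-inv h = begin
    ∑ (choose (suc (suc k)) (x ∷ xs ++ ys)) W
      ≡⟨ ∑-choose-∷ (suc k) x (xs ++ ys) W ⟩
    ∑ (choose (suc k) (xs ++ ys)) (W ∘ (x ∷_)) + ∑ (choose (suc (suc k)) (xs ++ ys)) W
      -- Sublists containing `x` are treated by induction with the weight `W ∘ (x ∷_)`, which is why
      -- the statement holds for all invariant weights at once.
      ≡⟨ cong₂ _+_ (∑-choose-++ k xs (W ∘ (x ∷_)) Pys (W-inv ∘ prep x) h′) (∑-choose-++ (suc k) xs W Pys W-inv h) ⟩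
    (a + ∑ ys f) + (b + ∑ ys g)
      ≡⟨ interchange a (∑ ys f) b (∑ ys g) ⟩
    (a + b) + (∑ ys f + ∑ ys g)
      ≡⟨ cong₂ _+_ (∑-choose-∷ (suc k) x xs W) (∑-+ ys f g) ⟨
    ∑ (choose (suc (suc k)) (x ∷ xs)) W + ∑ ys (λ y → f y + g y)
      ≡⟨ cong (∑ (choose (suc (suc k)) (x ∷ xs)) W +_) (∑-cong ys f+g) ⟩
    ∑ (choose (suc (suc k)) (x ∷ xs)) W + ∑ ys (λ y → ∑ (choose (suc k) (x ∷ xs)) (W ∘ (y ∷_))) ∎
    where
    open ≡-Reasoning
    a = ∑ (choose (suc k) xs) (W ∘ (x ∷_))
    b = ∑ (choose (suc (suc k)) xs) W
    f = λ y → ∑ (choose k xs) (λ s → W (x ∷ y ∷ s))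
    g = λ y → ∑ (choose (suc k) xs) (λ s → W (y ∷ s))
    -- Here `x` stands before the two conflicting entries; it is moved behind them.
    h′ : ∀ y z s → P y → P z → W (x ∷ y ∷ z ∷ s) ≡ 0
    h′ y z s py pz = trans (W-inv (↭-sym (shift x (y ∷ z ∷ []) s))) (h y z (x ∷ s) py pz)
    f+g : ∀ y → f y + g y ≡ ∑ (choose (suc k) (x ∷ xs)) (W ∘ (y ∷_))
    f+g y = trans (cong (_+ g y) (∑-cong (choose k xs) (λ s → W-inv (swap x y ↭-refl))))
                  (sym (∑-choose-∷ k x xs (W ∘ (y ∷_))))

  -- Both sides count the (k + 1)-sublists with a marked entry, by weight.
  ∑-choose-mark : ∀ k (xs : List A) (W : List A → ℕ) → PermutationInvariant W →
                  (∀ x s → W (x ∷ x ∷ s) ≡ 0) →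
                  ∑ xs (λ y → ∑ (choose k xs) (λ s → W (y ∷ s))) ≡ suc k * ∑ (choose (suc k) xs) W
  ∑-choose-mark zero xs W _ _ = begin
    ∑ xs (λ y → W [ y ] + 0)  ≡⟨ ∑-cong xs (λ y → +-identityʳ (W [ y ])) ⟩
    ∑ xs (W ∘ [_])            ≡⟨ ∑-choose-1 xs W ⟨
    ∑ (choose 1 xs) W         ≡⟨ +-identityʳ _ ⟨
    1 * ∑ (choose 1 xs) W     ∎
    where open ≡-Reasoning
  ∑-choose-mark (suc k) []       W _ _ = sym (*-zeroʳ k)
  ∑-choose-mark (suc k) (x ∷ xs) W W-inv dup = begin
    F x + ∑ xs F
      ≡⟨ cong₂ _+_ first (∑-cong xs other) ⟩
    a + ∑ xs (λ y → ∑ (choose k xs) (λ s → W (x ∷ y ∷ s)) + ∑ (choose (suc k) xs) (W ∘ (y ∷_)))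
      ≡⟨ cong (a +_) (∑-+ xs _ _) ⟩
    a + (∑ xs (λ y → ∑ (choose k xs) (λ s → W (x ∷ y ∷ s))) + ∑ xs (λ y → ∑ (choose (suc k) xs) (W ∘ (y ∷_))))
      ≡⟨ cong (a +_) (cong₂ _+_ (∑-choose-mark k xs (W ∘ (x ∷_)) (W-inv ∘ prep x) dup′)
                                (∑-choose-mark (suc k) xs W W-inv dup)) ⟩
    a + (suc k * a + suc (suc k) * b)
      ≡⟨ +-assoc a (suc k * a) _ ⟨
    suc (suc k) * a + suc (suc k) * b
      ≡⟨ *-distribˡ-+ (suc (suc k)) a b ⟨
    suc (suc k) * (a + b)
      ≡⟨ cong (suc (suc k) *_) (∑-choose-∷ (suc k) x xs W) ⟨
    suc (suc k) * ∑ (choose (suc (suc k)) (x ∷ xs)) W ∎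
    where
    open ≡-Reasoning
    F = λ y → ∑ (choose (suc k) (x ∷ xs)) (W ∘ (y ∷_))
    a = ∑ (choose (suc k) xs) (W ∘ (x ∷_))
    b = ∑ (choose (suc (suc k)) xs) W
    dup′ : ∀ y s → W (x ∷ y ∷ y ∷ s) ≡ 0
    dup′ y s = trans (W-inv (↭-sym (shift x (y ∷ y ∷ []) s))) (dup y (x ∷ s))
    -- When the head is marked, choosing it a second time gives a repeated entry of weight 0, so
    -- only sublists of `xs` remain.
    first : F x ≡ a
    first = trans (∑-choose-∷ k x xs (W ∘ (x ∷_)))
      (cong (_+ a) (trans (∑-cong (choose k xs) (dup x)) (∑-0 (choose k xs))))
    other : ∀ y → F y ≡ ∑ (choose k xs) (λ s → W (x ∷ y ∷ s)) + ∑ (choose (suc k) xs) (W ∘ (y ∷_))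
    other y = trans (∑-choose-∷ k x xs (W ∘ (y ∷_)))
      (cong (_+ ∑ (choose (suc k) xs) (W ∘ (y ∷_)))
            (∑-cong (choose k xs) (λ s → W-inv (swap y x ↭-refl))))

  𝟙-invariant : {P : List A → Set} (P? : Decidable P) → P Respects _↭_ → PermutationInvariant (𝟙 ∘ P?)
  𝟙-invariant P? resp s↭t = 𝟙-⇔ (P? _) (P? _) (resp s↭t) (resp (↭-sym s↭t))

  -- `AllPairs` relates an entry only to later ones, hence the symmetry of `R`.
  AllPairs-resp-↭ : {R : A → A → Set} → Symmetric R → AllPairs R Respects _↭_
  AllPairs-resp-↭ {R = R} R-sym s↭t =
    ↭ₛ.AllPairs-resp-↭ (setoid _) R-sym (subst (R _) , subst (λ x → R x _)) (↭⇒↭ₛ s↭t)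

  -- Stirling numbers of the second kind

  Disjoint : ∀ {n} → Subset n → Subset n → Set
  Disjoint p q = Empty (p ∩ q)

  DisjointFamily : ∀ {n} → List (Subset n) → Set
  DisjointFamily s = All Nonempty s × AllPairs Disjoint s

  disjoint? : ∀ {n} (p q : Subset n) → Dec (Disjoint p q)
  disjoint? p q = ¬? (nonempty? (p ∩ q))

  disjointFamily? : ∀ {n} (s : List (Subset n)) → Dec (DisjointFamily s)
  disjointFamily? s = all? nonempty? s ×-dec allPairs? disjoint? s

  disjoint-sym : ∀ {n} → Symmetric (Disjoint {n})
  disjoint-sym {x = p} {q} = subst Empty (∩-comm p q)

  -- The number F(n, d). Since `subsets n` lists every subset once, families are counted without
  -- regard to order.
  disjointFamilies : ℕ → ℕ → ℕ
  disjointFamilies n d = ∑ (choose d (subsets n)) (𝟙 ∘ disjointFamily?)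

  disjointFamily-resp-↭ : ∀ {n} → DisjointFamily {n} Respects _↭_
  disjointFamily-resp-↭ s↭t (ne , dj) = All-resp-↭ s↭t ne , AllPairs-resp-↭ disjoint-sym s↭t dj

  ⋃-↭ : ∀ {n} {s t : List (Subset n)} → s ↭ t → ⋃ s ≡ ⋃ t
  ⋃-↭ {n} s↭t = ↭ₛ.foldr-commMonoid (setoid _) (∪-isCommutativeMonoid n) (↭⇒↭ₛ s↭t)

  isPartition-resp-↭ : ∀ {n} → IsPartition {n} Respects _↭_
  isPartition-resp-↭ s↭t (ne , dj , cov) =
    All-resp-↭ s↭t ne , AllPairs-resp-↭ disjoint-sym s↭t dj , trans (sym (⋃-↭ s↭t)) cov

  nonempty-out⁻ : ∀ {n} {p : Subset n} → Nonempty (outside ∷ p) → Nonempty p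
  nonempty-out⁻ (suc x , there x∈p) = x , x∈p

  nonempty-out⁺ : ∀ {n} {p : Subset n} {b} → Nonempty p → Nonempty (b ∷ p)
  nonempty-out⁺ (x , x∈p) = suc x , there x∈p

  disjointFamily-out⁻ : ∀ {n} {s : List (Subset n)} → DisjointFamily (map (outside ∷_) s) → DisjointFamily s
  disjointFamily-out⁻ (ne , dj) =
    All.map nonempty-out⁻ (All.map⁻ ne) , AllPairs.map (_∘ nonempty-out⁺) (AllPairs.map⁻ dj)

  disjointFamily-out⁺ : ∀ {n} {s : List (Subset n)} → DisjointFamily s → DisjointFamily (map (outside ∷_) s)
  disjointFamily-out⁺ (ne , dj) =
    All.map⁺ (All.map nonempty-out⁺ ne) , AllPairs.map⁺ (AllPairs.map (_∘ nonempty-out⁻) dj)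

  -- The element zero lies in none of the other sets, so disjointness depends only on `y`. Nothing
  -- is said about `Nonempty y`, because zero alone makes `inside ∷ y` nonempty.
  disjointFamily-in⁻ : ∀ {n} {y : Subset n} {s} → DisjointFamily ((inside ∷ y) ∷ map (outside ∷_) s) →
                       DisjointFamily s × All (Disjoint y) s
  disjointFamily-in⁻ (_ ∷ ne , ys ∷ dj) =
    disjointFamily-out⁻ (ne , dj) , All.map (_∘ nonempty-out⁺) (All.map⁻ ys)

  disjointFamily-in⁺ : ∀ {n} {y : Subset n} {s} → DisjointFamily s × All (Disjoint y) s →
                       DisjointFamily ((inside ∷ y) ∷ map (outside ∷_) s)
  disjointFamily-in⁺ (fam , ys) with disjointFamily-out⁺ fam
  ... | ne , dj = (zero , here) ∷ ne , All.map⁺ (All.map (_∘ nonempty-out⁻) ys) ∷ dj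

  in-in-overlap : ∀ {n} (p q : Subset n) → ¬ Disjoint (inside ∷ p) (inside ∷ q)
  in-in-overlap p q dj = dj (zero , here)

  _≟ˢ_ : ∀ {n} (p q : Subset n) → Dec (p ≡ q)
  _≟ˢ_ = ≡-dec _≟ᵇ_

  -- Evaluates sums over `y` in which `y` is forced, once to be a complement and once to be `⊥`.
  ∑-subsets-≡ : ∀ {n} (z : Subset n) → ∑ (subsets n) (λ y → 𝟙 (y ≟ˢ z)) ≡ 1
  ∑-subsets-≡ []            = refl
  ∑-subsets-≡ {suc n} (b ∷ z) = trans (∑-++ (map (outside ∷_) (subsets n)) _ _) (trans
    (cong₂ _+_ (∑-map _ (subsets n) _) (∑-map _ (subsets n) _)) (go b))
    where
    same : ∀ b → ∑ (subsets n) (λ y → 𝟙 ((b ∷ y) ≟ˢ (b ∷ z))) ≡ 1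
    same b = trans (∑-cong (subsets n) (λ y → 𝟙-⇔ ((b ∷ y) ≟ˢ (b ∷ z)) (y ≟ˢ z) ∷-injectiveʳ (cong (b ∷_))))
                   (∑-subsets-≡ z)
    diff : ∀ b b′ → b ≢ b′ → ∑ (subsets n) (λ y → 𝟙 ((b ∷ y) ≟ˢ (b′ ∷ z))) ≡ 0
    diff b b′ b≢b′ = trans (∑-cong (subsets n) (λ y → 𝟙-no ((b ∷ y) ≟ˢ (b′ ∷ z)) (b≢b′ ∘ ∷-injectiveˡ)))
                           (∑-0 (subsets n))
    go : ∀ b → ∑ (subsets n) (λ y → 𝟙 ((outside ∷ y) ≟ˢ (b ∷ z))) +
               ∑ (subsets n) (λ y → 𝟙 ((inside ∷ y) ≟ˢ (b ∷ z))) ≡ 1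
    go outside = cong₂ _+_ (same outside) (diff inside outside λ ())
    go inside  = cong₂ _+_ (diff outside inside λ ()) (same inside)

  -- Two sets that both contain the element zero cannot occur together.
  ∑-choose-subsets : ∀ n d (W : List (Subset (suc n)) → ℕ) → PermutationInvariant W →
    (∀ p q s → W ((inside ∷ p) ∷ (inside ∷ q) ∷ s) ≡ 0) →
    ∑ (choose (suc d) (subsets (suc n))) W ≡
    ∑ (choose (suc d) (subsets n)) (W ∘ map (outside ∷_)) +
    ∑ (subsets n) (λ y → ∑ (choose d (subsets n)) (λ s → W ((inside ∷ y) ∷ map (outside ∷_) s)))
  ∑-choose-subsets n d W W-inv clash = begin
    ∑ (choose (suc d) (map (outside ∷_) X ++ map (inside ∷_) X)) W
      ≡⟨ ∑-choose-++ d (map (outside ∷_) X) W ins W-inv (λ { _ _ s (p , refl) (q , refl) → clash p q s }) ⟩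
    ∑ (choose (suc d) (map (outside ∷_) X)) W +
    ∑ (map (inside ∷_) X) (λ y → ∑ (choose d (map (outside ∷_) X)) (W ∘ (y ∷_)))
      ≡⟨ cong₂ _+_ (∑-choose-map _ (suc d) X W) (∑-map _ X _) ⟩
    ∑ (choose (suc d) X) (W ∘ map (outside ∷_)) +
    ∑ X (λ y → ∑ (choose d (map (outside ∷_) X)) (W ∘ ((inside ∷ y) ∷_)))
      ≡⟨ cong (∑ (choose (suc d) X) (W ∘ map (outside ∷_)) +_) (∑-cong X (λ y → ∑-choose-map _ d X _)) ⟩
    _ ∎
    where
    open ≡-Reasoning
    X = subsets n
    ins : All (λ x → ∃[ p ] x ≡ inside ∷ p) (map (inside ∷_) X)
    ins = All.map⁺ (All.universal (λ p → p , refl) X)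

  ⋃-out : ∀ {n} (s : List (Subset n)) → ⋃ (map (outside ∷_) s) ≡ outside ∷ ⋃ s
  ⋃-out []      = refl
  ⋃-out (p ∷ s) = cong ((outside ∷ p) ∪_) (⋃-out s)

  disjoint-⋃⁺ : ∀ {n} {y : Subset n} {s} → All (Disjoint y) s → Disjoint y (⋃ s)
  disjoint-⋃⁺ {y = y} {s} dj (x , x∈) with x∈p∩q⁻ y (⋃ s) x∈
  ... | x∈y , x∈⋃ = go s dj x∈⋃
    where
    go : ∀ s → All (Disjoint y) s → ¬ (x ∈ ⋃ s)
    go []      _          x∈⊥ = ∉⊥ x∈⊥
    go (p ∷ s) (yp ∷ ys)  x∈∪ with x∈p∪q⁻ p (⋃ s) x∈∪
    ... | inj₁ x∈p = yp (x , x∈p∩q⁺ (x∈y , x∈p))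
    ... | inj₂ x∈s = go s ys x∈s

  disjoint-⋃⁻ : ∀ {n} {y : Subset n} s → Disjoint y (⋃ s) → All (Disjoint y) s
  disjoint-⋃⁻ []      _ = []
  disjoint-⋃⁻ {y = y} (p ∷ s) dj = via (x∈p∪q⁺ ∘ inj₁) ∷ disjoint-⋃⁻ s (via (x∈p∪q⁺ {p = p} ∘ inj₂))
    where
    via : ∀ {q} → q ⊆ ⋃ (p ∷ s) → Disjoint y q
    via {q} q⊆ (x , x∈) with x∈p∩q⁻ y q x∈
    ... | x∈y , x∈q = dj (x , x∈p∩q⁺ (x∈y , q⊆ x∈q))

  -- Disjointness gives one inclusion and covering the other.
  complement-unique : ∀ {n} {y u : Subset n} → Disjoint y u → y ∪ u ≡ ⊤ → y ≡ ∁ u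
  complement-unique {y = y} {u} dj cov = ⊆-antisym
    (λ x∈y → x∉p⇒x∈∁p (λ x∈u → dj (_ , x∈p∩q⁺ (x∈y , x∈u))))
    λ {x} x∈∁u → [ (λ x∈y → x∈y) , (λ x∈u → contradiction x∈∁u (x∈p⇒x∉∁p x∈u)) ]′
      (x∈p∪q⁻ y u (subst (x ∈_) (sym cov) ∈⊤))

  ∁-disjoint : ∀ {n} (u : Subset n) → Disjoint (∁ u) u
  ∁-disjoint u (x , x∈) with x∈p∩q⁻ (∁ u) u x∈
  ... | x∈∁u , x∈u = x∈p⇒x∉∁p x∈u x∈∁u

  isPartition-in⁻ : ∀ {n} {y : Subset n} {s} → IsPartition ((inside ∷ y) ∷ map (outside ∷_) s) →
                    DisjointFamily s × y ≡ ∁ (⋃ s)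
  isPartition-in⁻ {y = y} {s} (ne , dj , cov) with disjointFamily-in⁻ (ne , dj)
  ... | fam , ys = fam , complement-unique (disjoint-⋃⁺ ys)
    (∷-injectiveʳ (trans (sym (cong ((inside ∷ y) ∪_) (⋃-out s))) cov))

  isPartition-in⁺ : ∀ {n} {y : Subset n} {s} → DisjointFamily s × y ≡ ∁ (⋃ s) →
                    IsPartition ((inside ∷ y) ∷ map (outside ∷_) s)
  isPartition-in⁺ {s = s} (fam , refl) with disjointFamily-in⁺ (fam , disjoint-⋃⁻ s (∁-disjoint (⋃ s)))
  ... | ne , dj = ne , dj , trans (cong ((inside ∷ ∁ (⋃ s)) ∪_) (⋃-out s))
    (cong (inside ∷_) (trans (∪-comm (∁ (⋃ s)) (⋃ s)) (p∪∁p≡⊤ (⋃ s))))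

  stirling₂-∑ : ∀ n d → stirling₂ n d ≡ ∑ (choose d (subsets n)) (𝟙 ∘ isPartition?)
  stirling₂-∑ n d = length-filter-∑ isPartition? (choose d (subsets n))

  -- The block containing the element zero is determined by the other blocks.
  stirling₂-disjointFamilies : ∀ n d → stirling₂ (suc n) (suc d) ≡ disjointFamilies n d
  stirling₂-disjointFamilies n d = begin
    stirling₂ (suc n) (suc d)
      ≡⟨ stirling₂-∑ (suc n) (suc d) ⟩
    ∑ (choose (suc d) (subsets (suc n))) W
      ≡⟨ ∑-choose-subsets n d W (𝟙-invariant isPartition? isPartition-resp-↭) (λ p q s →
           𝟙-no (isPartition? ((inside ∷ p) ∷ (inside ∷ q) ∷ s)) λ { (_ , (pq ∷ _) ∷ _ , _) → in-in-overlap p q pq }) ⟩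
    ∑ (choose (suc d) X) (W ∘ map (outside ∷_)) +
    ∑ X (λ y → ∑ (choose d X) (λ s → W ((inside ∷ y) ∷ map (outside ∷_) s)))
      ≡⟨ cong₂ _+_ (trans (∑-cong (choose (suc d) X) uncovered) (∑-0 (choose (suc d) X)))
                   (∑-cong X (λ y → ∑-cong (choose d X) (λ s → covered y s))) ⟩
    ∑ X (λ y → ∑ (choose d X) (λ s → 𝟙 (disjointFamily? s) * 𝟙 (y ≟ˢ ∁ (⋃ s))))
      -- With the sum over `y` innermost, the equation `y ≟ˢ ∁ (⋃ s)` selects exactly one term for
      -- each `s`.
      ≡⟨ ∑-swap X (choose d X) _ ⟩
    ∑ (choose d X) (λ s → ∑ X (λ y → 𝟙 (disjointFamily? s) * 𝟙 (y ≟ˢ ∁ (⋃ s))))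
      ≡⟨ ∑-cong (choose d X) (λ s → trans (∑-*ˡ X (𝟙 (disjointFamily? s)) _)
           (trans (cong (𝟙 (disjointFamily? s) *_) (∑-subsets-≡ (∁ (⋃ s)))) (*-identityʳ _))) ⟩
    disjointFamilies n d ∎
    where
    open ≡-Reasoning
    X = subsets n
    W = 𝟙 ∘ isPartition?
    -- No set of the family contains zero, so the union cannot be everything.
    uncovered : ∀ s → W (map (outside ∷_) s) ≡ 0
    uncovered s = 𝟙-no (isPartition? (map (outside ∷_) s)) λ (_ , _ , cov) →
      contradiction (trans (sym (⋃-out s)) cov) λ ()
    covered : ∀ y s → W ((inside ∷ y) ∷ map (outside ∷_) s) ≡ 𝟙 (disjointFamily? s) * 𝟙 (y ≟ˢ ∁ (⋃ s))
    covered y s = trans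
      (𝟙-⇔ (isPartition? ((inside ∷ y) ∷ map (outside ∷_) s)) (disjointFamily? s ×-dec (y ≟ˢ ∁ (⋃ s))) isPartition-in⁻ isPartition-in⁺)
      (𝟙-× (disjointFamily? s) (y ≟ˢ ∁ (⋃ s)))

  disjointFamilies-0-suc : ∀ d → disjointFamilies 0 (suc d) ≡ 0
  disjointFamilies-0-suc zero    = refl
  disjointFamilies-0-suc (suc d) = refl

  -- Removing the element zero from its block, if it lies in one, leaves either
  -- the empty set or a marked member of a family of suc d sets.
  disjointFamilies-suc : ∀ n d → disjointFamilies (suc n) (suc d) ≡
                         disjointFamilies n d + suc (suc d) * disjointFamilies n (suc d)
  disjointFamilies-suc n d = begin
    ∑ (choose (suc d) (subsets (suc n))) W
      ≡⟨ ∑-choose-subsets n d W (𝟙-invariant disjointFamily? disjointFamily-resp-↭) (λ p q s →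
           𝟙-no (disjointFamily? ((inside ∷ p) ∷ (inside ∷ q) ∷ s)) λ { (_ , (pq ∷ _) ∷ _) → in-in-overlap p q pq }) ⟩
    ∑ (choose (suc d) X) (W ∘ map (outside ∷_)) +
    ∑ X (λ y → ∑ (choose d X) (λ s → W ((inside ∷ y) ∷ map (outside ∷_) s)))
      ≡⟨ cong₂ _+_ (∑-cong (choose (suc d) X) without)
                   (∑-cong X (λ y → ∑-cong (choose d X) (λ s → within y s))) ⟩
    b + ∑ X (λ y → ∑ (choose d X) (λ s → W (y ∷ s) + W s * 𝟙 (y ≟ˢ ⊥)))
      ≡⟨ cong (b +_) (trans (∑-cong X (λ y → ∑-+ (choose d X) _ _)) (∑-+ X _ _)) ⟩
    b + (∑ X (λ y → ∑ (choose d X) (λ s → W (y ∷ s))) + ∑ X (λ y → ∑ (choose d X) (λ s → W s * 𝟙 (y ≟ˢ ⊥))))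
      ≡⟨ cong (b +_) (cong₂ _+_
           (∑-choose-mark d X W (𝟙-invariant disjointFamily? disjointFamily-resp-↭) dup)
           (trans (∑-swap X (choose d X) _) (∑-cong (choose d X) (λ s →
             trans (∑-*ˡ X (W s) _) (trans (cong (W s *_) (∑-subsets-≡ {n} ⊥)) (*-identityʳ (W s))))))) ⟩
    b + (suc d * b + a)
      ≡⟨ +-assoc b (suc d * b) a ⟨
    suc (suc d) * b + a
      ≡⟨ +-comm _ a ⟩
    a + suc (suc d) * b ∎
    where
    open ≡-Reasoning
    X = subsets n
    W : ∀ {n} → List (Subset n) → ℕ
    W s = 𝟙 (disjointFamily? s)
    a = disjointFamilies n d
    b = disjointFamilies n (suc d)
    without : ∀ s → W (map (outside ∷_) s) ≡ W s
    without s = 𝟙-⇔ (disjointFamily? (map (outside ∷_) s)) (disjointFamily? s) disjointFamily-out⁻ disjointFamily-out⁺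
    -- A set disjoint from itself is empty, and members of a family are nonempty.
    dup : ∀ y s → W (y ∷ y ∷ s) ≡ 0
    dup y s = 𝟙-no (disjointFamily? (y ∷ y ∷ s)) λ { ((ne ∷ _) , (dj ∷ _) ∷ _) →
      subst Empty (∩-idem y) dj ne }
    disjoint-⊥ : ∀ s → All (Disjoint ⊥) s
    disjoint-⊥ = All.universal λ q (x , x∈) → ∉⊥ (proj₁ (x∈p∩q⁻ ⊥ q x∈))
    within : ∀ y s → W ((inside ∷ y) ∷ map (outside ∷_) s) ≡ W (y ∷ s) + W s * 𝟙 (y ≟ˢ ⊥)
    within y s with y ≟ˢ ⊥
    -- The set containing zero is a singleton here and is disjoint from every set of `s`. The term
    -- `W (⊥ ∷ s)` vanishes because `⊥` is not allowed in a family.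
    ... | yes refl = trans
      (𝟙-⇔ (disjointFamily? ((inside ∷ y) ∷ map (outside ∷_) s)) (disjointFamily? s)
        (proj₁ ∘ disjointFamily-in⁻) (λ fam → disjointFamily-in⁺ (fam , disjoint-⊥ s)))
      (sym (cong₂ _+_ (𝟙-no (disjointFamily? (⊥ ∷ s)) λ { ((x , x∈⊥) ∷ _ , _) → ∉⊥ x∈⊥ })
                      (*-identityʳ (W s))))
    ... | no y≢⊥ = trans
      (𝟙-⇔ (disjointFamily? ((inside ∷ y) ∷ map (outside ∷_) s)) (disjointFamily? (y ∷ s)) into
        (λ { (_ ∷ ne , ys ∷ dj) → disjointFamily-in⁺ ((ne , dj) , ys) }))
      (sym (trans (cong (W (y ∷ s) +_) (*-zeroʳ (W s))) (+-identityʳ _)))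
      where
      into : DisjointFamily ((inside ∷ y) ∷ map (outside ∷_) s) → DisjointFamily (y ∷ s)
      into fam with disjointFamily-in⁻ fam
      ... | (ne , dj) , ys = y-ne ∷ ne , ys ∷ dj
        where
        y-ne : Nonempty y
        y-ne = decidable-stable (nonempty? y) (y≢⊥ ∘ Empty-unique)

  stirling₂-0-suc : ∀ d → stirling₂ 0 (suc d) ≡ 0
  stirling₂-0-suc zero    = refl
  stirling₂-0-suc (suc d) = refl

  -- Through S(n + 1, d + 1) = F(n, d) this becomes the recurrence of F. That identity reaches only
  -- positive indices, so n = 0 and d = 0 are treated separately.
  stirling₂-suc : ∀ n d → stirling₂ (suc n) (suc d) ≡ stirling₂ n d + suc d * stirling₂ n (suc d)
  stirling₂-suc zero    zero    = refl
  stirling₂-suc zero    (suc d) = begin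
    stirling₂ 1 (suc (suc d))     ≡⟨ stirling₂-disjointFamilies 0 (suc d) ⟩
    disjointFamilies 0 (suc d)    ≡⟨ disjointFamilies-0-suc d ⟩
    0                             ≡⟨ cong₂ _+_ (stirling₂-0-suc d) (*-zeroʳ d) ⟨
    stirling₂ 0 (suc d) + suc (suc d) * stirling₂ 0 (suc (suc d)) ∎
    where open ≡-Reasoning
  -- The empty family does not cover a nonempty set, so `stirling₂ (suc n) 0` computes to 0 and
  -- drops out.
  stirling₂-suc (suc n) zero = begin
    stirling₂ (suc (suc n)) 1     ≡⟨ stirling₂-disjointFamilies (suc n) 0 ⟩
    1                             ≡⟨ cong (_+ 0) (stirling₂-disjointFamilies n 0) ⟨
    1 * stirling₂ (suc n) 1       ∎
    where open ≡-Reasoning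
  stirling₂-suc (suc n) (suc d) = begin
    stirling₂ (suc (suc n)) (suc (suc d))
      ≡⟨ stirling₂-disjointFamilies (suc n) (suc d) ⟩
    disjointFamilies (suc n) (suc d)
      ≡⟨ disjointFamilies-suc n d ⟩
    disjointFamilies n d + suc (suc d) * disjointFamilies n (suc d)
      ≡⟨ cong₂ (λ x y → x + suc (suc d) * y) (stirling₂-disjointFamilies n d) (stirling₂-disjointFamilies n (suc d)) ⟨
    stirling₂ (suc n) (suc d) + suc (suc d) * stirling₂ (suc n) (suc (suc d)) ∎
    where open ≡-Reasoning

  stirling₂-< : ∀ {n d} → n < d → stirling₂ n d ≡ 0
  stirling₂-< {zero}  {suc d} _         = stirling₂-0-suc d
  stirling₂-< {suc n} {suc d} (s≤s n<d) = trans (stirling₂-suc n d)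
    (trans (cong₂ (λ x y → x + suc d * y) (stirling₂-< n<d) (stirling₂-< (m<n⇒m<1+n n<d))) (*-zeroʳ d))

  stirling₂-diagonal : ∀ n → stirling₂ n n ≡ 1
  stirling₂-diagonal zero    = refl
  stirling₂-diagonal (suc n) = trans (stirling₂-suc n n)
    (trans (cong₂ (λ x y → x + suc n * y) (stirling₂-diagonal n) (stirling₂-< (n<1+n n))) (cong suc (*-zeroʳ n)))

  -- Rows of a column outside given levels.

  ∑-upTo-+ : ∀ a b (f : ℕ → ℕ) → ∑ (upTo (a + b)) f ≡ ∑ (upTo a) f + ∑ (upTo b) (λ i → f (a + i))
  ∑-upTo-+ a b f = begin
    ∑ (upTo (a + b)) f                                    ≡⟨ cong sum (map-upTo f (a + b)) ⟩
    sum (applyUpTo f (a + b))                             ≡⟨ go a f ⟩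
    sum (applyUpTo f a) + sum (applyUpTo (f ∘ (a +_)) b)  ≡⟨ cong₂ _+_ (cong sum (map-upTo f a)) (cong sum (map-upTo (f ∘ (a +_)) b)) ⟨
    ∑ (upTo a) f + ∑ (upTo b) (f ∘ (a +_))                ∎
    where
    open ≡-Reasoning
    go : ∀ a (f : ℕ → ℕ) → sum (applyUpTo f (a + b)) ≡ sum (applyUpTo f a) + sum (applyUpTo (f ∘ (a +_)) b)
    go zero    f = refl
    go (suc a) f = trans (cong (f 0 +_) (go a (f ∘ suc))) (sym (+-assoc (f 0) _ _))

  ∑-upTo-const : ∀ n {f : ℕ → ℕ} c → (∀ {i} → i < n → f i ≡ c) → ∑ (upTo n) f ≡ n * c
  ∑-upTo-const n {f} c h = trans (cong sum (map-upTo f n)) (go n h)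
    where
    go : ∀ n {f : ℕ → ℕ} → (∀ {i} → i < n → f i ≡ c) → sum (applyUpTo f n) ≡ n * c
    go zero    h = refl
    go (suc n) h = cong₂ _+_ (h (s≤s z≤n)) (go n (h ∘ s≤s))

  module _ (m : ℕ) .{{_ : NonZero m}} where

    -- Rows and levels are counted from 0 here. The column splits into `q * m` rows below the level,
    -- the `m` rows of the level, and `t` rows above it; the hypothesis says that the level is full.
    ∑-level : ∀ q {h} → suc q * m ≤ h → ∑ (upTo h) (λ i → 𝟙 (q ≟ i / m)) ≡ m
    ∑-level q {h} q≤h = begin
      ∑ (upTo h) f
        ≡⟨ cong (λ h → ∑ (upTo h) f) h≡ ⟩
      ∑ (upTo (q * m + (m + t))) f
        ≡⟨ ∑-upTo-+ (q * m) (m + t) f ⟩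
      ∑ (upTo (q * m)) f + ∑ (upTo (m + t)) (f ∘ (q * m +_))
        ≡⟨ cong (∑ (upTo (q * m)) f +_) (∑-upTo-+ m t (f ∘ (q * m +_))) ⟩
      ∑ (upTo (q * m)) f + (∑ (upTo m) (f ∘ (q * m +_)) + ∑ (upTo t) (λ i → f (q * m + (m + i))))
        ≡⟨ cong₂ _+_ (∑-upTo-const (q * m) 0 below)
             (cong₂ _+_ (∑-upTo-const m 1 within) (∑-upTo-const t 0 (λ {i} _ → above i))) ⟩
      q * m * 0 + (m * 1 + t * 0)
        ≡⟨ simplify (q * m) m t ⟩
      m ∎
      where
      open ≡-Reasoning
      f = λ i → 𝟙 (q ≟ i / m)
      t = h ∸ suc q * m
      simplify : ∀ a b c → a * 0 + (b * 1 + c * 0) ≡ b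
      simplify = solve-∀
      h≡ : h ≡ q * m + (m + t)
      h≡ = begin
        h                    ≡⟨ m+[n∸m]≡n q≤h ⟨
        m + q * m + t        ≡⟨ cong (_+ t) (+-comm m (q * m)) ⟩
        q * m + m + t        ≡⟨ +-assoc (q * m) m t ⟩
        q * m + (m + t)      ∎
      below : ∀ {i} → i < q * m → f i ≡ 0
      below {i} i<qm = 𝟙-no (q ≟ i / m) (≢-sym (<⇒≢ (m<n*o⇒m/o<n {i} {q} {m} i<qm)))
      within : ∀ {i} → i < m → f (q * m + i) ≡ 1
      within {i} i<m = 𝟙-yes (q ≟ (q * m + i) / m) (sym (begin
        (q * m + i) / m       ≡⟨ +-distrib-/-∣ˡ i (n∣m*n q) ⟩
        q * m / m + i / m     ≡⟨ cong₂ _+_ (m*n/n≡m q m) (m<n⇒m/n≡0 i<m) ⟩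
        q + 0                 ≡⟨ +-identityʳ q ⟩
        q                     ∎))
      above : ∀ i → f (q * m + (m + i)) ≡ 0
      above i = 𝟙-no (q ≟ (q * m + (m + i)) / m) (<⇒≢ (subst (_≤ (q * m + (m + i)) / m) (m*n/n≡m (suc q) m)
        (/-monoˡ-≤ m (≤-trans (≤-reflexive (+-comm m (q * m))) (+-monoʳ-≤ (q * m) (m≤m+n m i))))))

    -- The row `suc i` has level `suc (i / m)`, so `i / m` is its level counted from 0.
    avoids? : ∀ i (qs : List ℕ) → Dec (All (_≢ i / m) qs)
    avoids? i = all? (λ q → ¬? (q ≟ i / m))

    -- Distinct full levels occupy disjoint sets of `m` rows each. The blocked rows are added on the
    -- left so that no truncated subtraction occurs.
    ∑-avoids : ∀ {h} qs → AllPairs _≢_ qs → All (λ q → suc q * m ≤ h) qs →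
               ∑ (upTo h) (λ i → 𝟙 (avoids? i qs)) + length qs * m ≡ h
    ∑-avoids {h} [] _ _ = trans (+-identityʳ _) (trans (∑-upTo-const h 1 (λ _ → refl)) (*-identityʳ h))
    ∑-avoids {h} (q ∷ qs) (q∉ ∷ uniq) (q≤h ∷ qs≤h) = begin
      ∑ (upTo h) (λ i → 𝟙 (avoids? i (q ∷ qs))) + (m + length qs * m)
        ≡⟨ +-assoc (∑ (upTo h) (λ i → 𝟙 (avoids? i (q ∷ qs)))) m (length qs * m) ⟨
      ∑ (upTo h) (λ i → 𝟙 (avoids? i (q ∷ qs))) + m + length qs * m
        ≡⟨ cong (λ z → ∑ (upTo h) (λ i → 𝟙 (avoids? i (q ∷ qs))) + z + length qs * m) (∑-level q q≤h) ⟨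
      ∑ (upTo h) (λ i → 𝟙 (avoids? i (q ∷ qs))) + ∑ (upTo h) (λ i → 𝟙 (q ≟ i / m)) + length qs * m
        ≡⟨ cong (_+ length qs * m) (∑-+ (upTo h) _ _) ⟨
      ∑ (upTo h) (λ i → 𝟙 (avoids? i (q ∷ qs)) + 𝟙 (q ≟ i / m)) + length qs * m
        ≡⟨ cong (_+ length qs * m) (∑-cong (upTo h) split) ⟩
      ∑ (upTo h) (λ i → 𝟙 (avoids? i qs)) + length qs * m
        ≡⟨ ∑-avoids qs uniq qs≤h ⟩
      h ∎
      where
      open ≡-Reasoning
      -- A row of level `q` avoids all of `qs`, because the levels are distinct; any other row is
      -- unaffected by `q`.
      split : ∀ i → 𝟙 (avoids? i (q ∷ qs)) + 𝟙 (q ≟ i / m) ≡ 𝟙 (avoids? i qs)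
      split i = go (q ≟ i / m)
        where
        go : Dec (q ≡ i / m) → 𝟙 (avoids? i (q ∷ qs)) + 𝟙 (q ≟ i / m) ≡ 𝟙 (avoids? i qs)
        go (yes q≡) = trans
          (cong₂ _+_ (𝟙-no (avoids? i (q ∷ qs)) λ { (q≢ ∷ _) → q≢ q≡ }) (𝟙-yes (q ≟ i / m) q≡))
          (sym (𝟙-yes (avoids? i qs) (All.map (λ q≢r r≡ → q≢r (trans q≡ (sym r≡))) q∉)))
        go (no q≢) = trans
          (cong₂ _+_ (𝟙-⇔ (avoids? i (q ∷ qs)) (avoids? i qs) All.tail (q≢ ∷_)) (𝟙-no (q ≟ i / m) q≢))
          (+-identityʳ _)

  -- Rook numbers of singleton boards

  tabulate-∷ʳ : ∀ {n} (f : Fin (suc n) → A) → tabulate f ≡ tabulate (f ∘ inject₁) ++ [ f (fromℕ n) ]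
  tabulate-∷ʳ {n = zero}  f = refl
  tabulate-∷ʳ {n = suc n} f = cong (f zero ∷_) (tabulate-∷ʳ (f ∘ suc))

  column : ∀ {N} → Fin N → ℕ → List (Cell N)
  column j h = map (λ i → j , suc i) (upTo h)

  dropLast : ∀ {N} → Board (suc N) → Board N
  dropLast B = B ∘ inject₁

  injectCell : ∀ {N} → Cell N → Cell (suc N)
  injectCell (j , r) = inject₁ j , r

  -- Columns are listed from left to right, so the last one forms the tail, which is where
  -- `∑-choose-++` expects the mutually conflicting entries.
  cells-dropLast : ∀ {N} (B : Board (suc N)) →
                   cells B ≡ map injectCell (cells (dropLast B)) ++ column (fromℕ N) (B (fromℕ N))
  cells-dropLast {N} B = begin
    concatMap col (allFin (suc N))
      ≡⟨ cong (concatMap col) (tabulate-∷ʳ id) ⟩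
    concatMap col (tabulate inject₁ ++ [ fromℕ N ])
      ≡⟨ concatMap-++ col (tabulate inject₁) [ fromℕ N ] ⟩
    concatMap col (tabulate inject₁) ++ (col (fromℕ N) ++ [])
      ≡⟨ cong₂ _++_ front (++-identityʳ (col (fromℕ N))) ⟩
    map injectCell (cells (dropLast B)) ++ col (fromℕ N) ∎
    where
    open ≡-Reasoning
    col : Fin (suc N) → List (Cell (suc N))
    col j = column j (B j)
    front : concatMap col (tabulate inject₁) ≡ map injectCell (cells (dropLast B))
    front = begin
      concatMap col (tabulate inject₁)         ≡⟨ cong (concatMap col) (map-tabulate id inject₁) ⟨
      concatMap col (map inject₁ (allFin N))   ≡⟨ concatMap-map col inject₁ (allFin N) ⟩
      concatMap (col ∘ inject₁) (allFin N)     ≡⟨ concatMap-cong (λ j → map-∘ (upTo (B (inject₁ j)))) (allFin N) ⟩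
      concatMap (map injectCell ∘ (λ j → column j (dropLast B j))) (allFin N)
                                               ≡⟨ map-concatMap injectCell _ (allFin N) ⟨
      map injectCell (cells (dropLast B))      ∎

  cells-bounded : ∀ {N} (B : Board N) → All (λ (j , r) → 1 ≤ r × r ≤ B j) (cells B)
  cells-bounded {N} B = All.concat⁺ (All.map⁺ (All.universal (λ j →
    All.map⁺ (All.map (λ i<Bj → s≤s z≤n , i<Bj) (All.all-upTo (B j)))) (allFin N)))

  module _ (m : ℕ) .{{_ : NonZero m}} where

    dropLast-singleton : ∀ {N} {B : Board (suc N)} → IsSingleton m B → IsSingleton m (dropLast B)
    dropLast-singleton {B = B} S = record
      { ferrers   = λ {i} {j} i≤j → ferrers (inject₁-mono i j i≤j)
      ; singleton = λ p i j ti ni tj nj → inject₁-injective (singleton p _ _ ti ni tj nj)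
      }
      where
      open IsSingleton S
      inject₁-mono : ∀ i j → toℕ i ≤ toℕ j → toℕ (inject₁ i) ≤ toℕ (inject₁ j)
      inject₁-mono i j rewrite toℕ-inject₁ i | toℕ-inject₁ j = id

    level-mono : ∀ {r s} → r ≤ s → level m r ≤ level m s
    level-mono r≤s = s≤s (/-monoˡ-≤ m (∸-monoˡ-≤ 1 r≤s))

    level-≤ : ∀ {r q} → 1 ≤ r → r ≤ q * m → level m r ≤ q
    level-≤ {suc r} _ r<qm = m<n*o⇒m/o<n r<qm

    terminates : ∀ {h} → 1 ≤ h → TerminatesIn m h (level m h)
    terminates {h} 1≤h = (h , 1≤h , ≤-refl , refl) , λ { q (r , _ , r≤h , refl) → level-mono r≤h }

    -- The column reaches row `r` but stops below the top of its level. A height `q * m` that is at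
    -- least `r` would reach that top, by `level-≤`.
    level-partial : ∀ {r h} → 1 ≤ r → r ≤ h → h < level m r * m → level m h ≡ level m r × m ∤ h
    level-partial {suc r} {h} 1≤r r≤h h<pm = ≤-antisym (level-≤ (≤-trans 1≤r r≤h) (<⇒≤ h<pm)) (level-mono r≤h) , no-div
      where
      no-div : m ∤ h
      no-div (divides q refl) = <-irrefl refl (<-≤-trans h<pm (*-monoˡ-≤ m (level-≤ {q = q} 1≤r r≤h)))

    -- Adding a rook in the last column.

    nonAttackingPlacement? : ∀ {N} (s : List (Cell N)) → Dec (AllPairs (NonAttacking m) s)
    nonAttackingPlacement? = allPairs? (nonAttacking? m)

    placed : ∀ {N} → List (Cell N) → ℕ
    placed s = 𝟙 (nonAttackingPlacement? s)

    nonAttacking-sym : ∀ {N} → Symmetric (NonAttacking m {N})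
    nonAttacking-sym (j≢ , l≢) = ≢-sym j≢ , ≢-sym l≢

    -- The level of the cell counted from 0, as in `∑-avoids`.
    quotient : ∀ {N} → Cell N → ℕ
    quotient (_ , r) = (r ∸ 1) / m

    nonAttacking-inject⁻ : ∀ {N} {s : List (Cell N)} → AllPairs (NonAttacking m) (map injectCell s) → AllPairs (NonAttacking m) s
    nonAttacking-inject⁻ ap = AllPairs.map (λ (j≢ , l≢) → j≢ ∘ cong inject₁ , l≢) (AllPairs.map⁻ ap)

    nonAttacking-inject⁺ : ∀ {N} {s : List (Cell N)} → AllPairs (NonAttacking m) s → AllPairs (NonAttacking m) (map injectCell s)
    nonAttacking-inject⁺ ap = AllPairs.map⁺ (AllPairs.map (λ (j≢ , l≢) → j≢ ∘ inject₁-injective , l≢) ap)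

    placed-injectCell : ∀ {N} (s : List (Cell N)) → placed (map injectCell s) ≡ placed s
    placed-injectCell s = 𝟙-⇔ (nonAttackingPlacement? (map injectCell s)) (nonAttackingPlacement? s) nonAttacking-inject⁻ nonAttacking-inject⁺

    -- The new rook shares its column with no earlier rook, so only the levels can conflict.
    placed-last : ∀ {N} i (s : List (Cell N)) → placed ((fromℕ N , suc i) ∷ map injectCell s) ≡ placed s * 𝟙 (avoids? m i (map quotient s))
    placed-last {N} i s = trans
      (𝟙-⇔ (nonAttackingPlacement? ((fromℕ N , suc i) ∷ map injectCell s))
           (nonAttackingPlacement? s ×-dec avoids? m i (map quotient s))
        (λ { (new ∷ ap) → nonAttacking-inject⁻ ap , All.map⁺ (All.map (λ (_ , l≢) q≡ → l≢ (cong suc (sym q≡))) (All.map⁻ new)) })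
        (λ (ap , av) → All.map⁺ (All.map (λ q≢ → fromℕ≢inject₁ , λ l≡ → q≢ (sym (suc-injective l≡))) (All.map⁻ av)) ∷ nonAttacking-inject⁺ ap))
      (𝟙-× (nonAttackingPlacement? s) (avoids? m i (map quotient s)))

    module _ {N} (B : Board (suc N)) (S : IsSingleton m B) where
      open IsSingleton S

      private
        H = B (fromℕ N)

      -- Otherwise column j and the last column both end inside the level of r,
      -- below its top row.
      cell-level-full : ∀ j {r} → 1 ≤ r → r ≤ dropLast B j → level m r * m ≤ H
      cell-level-full j {r} 1≤r r≤b = ≮⇒≥ λ H<pm →
        let b≤H        = ferrers (≤-trans (inject₁ℕ≤ j) (≤-reflexive (sym (toℕ-fromℕ N))))
            lb , m∤b   = level-partial 1≤r r≤b (≤-<-trans b≤H H<pm)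
            lH , m∤H   = level-partial 1≤r (≤-trans r≤b b≤H) H<pm
            b-ends     = subst (TerminatesIn m (dropLast B j)) lb (terminates (≤-trans 1≤r r≤b))
            H-ends     = subst (TerminatesIn m H) lH (terminates (≤-trans 1≤r (≤-trans r≤b b≤H)))
        in fromℕ≢inject₁ (singleton (level m r) _ _ H-ends m∤H b-ends m∤b)

      -- Nonattacking rooks of `s` lie in k distinct levels, each full in the last column by
      -- `cell-level-full`, so `∑-avoids` applies. If the rooks of `s` attack each other, both sides
      -- are 0.
      ∑-last : ∀ k s → All (λ (j , r) → 1 ≤ r × r ≤ dropLast B j) s → length s ≡ k →
               ∑ (upTo H) (λ i → placed ((fromℕ N , suc i) ∷ map injectCell s)) + k * m * placed s ≡ H * placed s
      ∑-last k s bd refl = begin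
        ∑ (upTo H) (λ i → placed ((fromℕ N , suc i) ∷ map injectCell s)) + length s * m * placed s
          ≡⟨ cong (_+ length s * m * placed s) (trans (∑-cong (upTo H) (λ i → placed-last i s)) (∑-*ˡ (upTo H) (placed s) _)) ⟩
        placed s * ∑ (upTo H) (λ i → 𝟙 (avoids? m i (map quotient s))) + length s * m * placed s
          ≡⟨ go (nonAttackingPlacement? s) ⟩
        H * placed s ∎
        where
        open ≡-Reasoning
        Q = ∑ (upTo H) (λ i → 𝟙 (avoids? m i (map quotient s)))
        go : (d : Dec (AllPairs (NonAttacking m) s)) → 𝟙 d * Q + length s * m * 𝟙 d ≡ H * 𝟙 d
        go (no _)   = trans (*-zeroʳ (length s * m)) (sym (*-zeroʳ H))
        go (yes ap) = begin
          1 * Q + length s * m * 1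
            ≡⟨ cong₂ _+_ (*-identityˡ Q) (*-identityʳ (length s * m)) ⟩
          Q + length s * m
            ≡⟨ cong (λ l → Q + l * m) (length-map quotient s) ⟨
          Q + length (map quotient s) * m
            ≡⟨ ∑-avoids m (map quotient s) (AllPairs.map⁺ (AllPairs.map (λ (_ , l≢) → l≢ ∘ cong suc) ap))
                 (All.map⁺ (All.map (λ { {j , suc r} (1≤r , r≤b) → cell-level-full j 1≤r r≤b }) bd)) ⟩
          H
            ≡⟨ *-identityʳ H ⟨
          H * 1 ∎

      -- r_{k+1}(B) = r_{k+1}(B') + (H - k m) r_k(B'), moved so that no
      -- subtraction occurs.
      rookNumber-suc : ∀ k → rookNumber m (suc k) B + k * m * rookNumber m k (dropLast B) ≡
                             rookNumber m (suc k) (dropLast B) + H * rookNumber m k (dropLast B)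
      rookNumber-suc k = begin
        rookNumber m (suc k) B + k * m * rookNumber m k B′
          ≡⟨ cong₂ (λ x y → x + k * m * y) last-split (length-filter-∑ nonAttackingPlacement? (choose k X)) ⟩
        (r + ∑ (choose k X) new) + k * m * ∑ (choose k X) placed
          ≡⟨ +-assoc r _ _ ⟩
        r + (∑ (choose k X) new + k * m * ∑ (choose k X) placed)
          ≡⟨ cong (λ z → r + (∑ (choose k X) new + z)) (∑-*ˡ (choose k X) (k * m) placed) ⟨
        r + (∑ (choose k X) new + ∑ (choose k X) (λ s → k * m * placed s))
          ≡⟨ cong (r +_) (∑-+ (choose k X) new _) ⟨
        r + ∑ (choose k X) (λ s → new s + k * m * placed s)
          ≡⟨ cong (r +_) (∑-choose-cong k (cells-bounded B′) (∑-last k)) ⟩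
        r + ∑ (choose k X) (λ s → H * placed s)
          ≡⟨ cong (r +_) (∑-*ˡ (choose k X) H placed) ⟩
        r + H * ∑ (choose k X) placed
          ≡⟨ cong (λ z → r + H * z) (length-filter-∑ nonAttackingPlacement? (choose k X)) ⟨
        r + H * rookNumber m k B′ ∎
        where
        open ≡-Reasoning
        B′ = dropLast B
        X = cells B′
        r = rookNumber m (suc k) B′
        L = column (fromℕ N) H
        new : List (Cell N) → ℕ
        new s = ∑ (upTo H) (λ i → placed ((fromℕ N , suc i) ∷ map injectCell s))
        in-last : All (λ c → proj₁ c ≡ fromℕ N) L
        in-last = All.map⁺ (All.universal (λ _ → refl) (upTo H))
        last-split : rookNumber m (suc k) B ≡ r + ∑ (choose k X) new
        last-split = begin
          rookNumber m (suc k) B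
            ≡⟨ length-filter-∑ nonAttackingPlacement? (choose (suc k) (cells B)) ⟩
          ∑ (choose (suc k) (cells B)) placed
            ≡⟨ cong (λ c → ∑ (choose (suc k) c) placed) (cells-dropLast B) ⟩
          ∑ (choose (suc k) (map injectCell X ++ L)) placed
            ≡⟨ ∑-choose-++ k (map injectCell X) placed in-last
                 (𝟙-invariant nonAttackingPlacement? (AllPairs-resp-↭ λ {x} {y} → nonAttacking-sym {x = x} {y}))
                 (λ x y s x≡ y≡ → 𝟙-no (nonAttackingPlacement? (x ∷ y ∷ s))
                   λ { (((x≢y , _) ∷ _) ∷ _) → x≢y (trans x≡ (sym y≡)) }) ⟩
          ∑ (choose (suc k) (map injectCell X)) placed + ∑ L (λ y → ∑ (choose k (map injectCell X)) (placed ∘ (y ∷_)))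
            ≡⟨ cong₂ _+_ (trans (∑-choose-map injectCell (suc k) X placed) (∑-cong (choose (suc k) X) placed-injectCell))
                         (∑-map _ (upTo H) _) ⟩
          ∑ (choose (suc k) X) placed + ∑ (upTo H) (λ i → ∑ (choose k (map injectCell X)) (placed ∘ ((fromℕ N , suc i) ∷_)))
            ≡⟨ cong₂ _+_ (length-filter-∑ nonAttackingPlacement? (choose (suc k) X))
                 (trans (∑-swap (choose k X) (upTo H) _) (∑-cong (upTo H) (λ i → sym (∑-choose-map injectCell k X _)))) ⟨
          r + ∑ (choose k X) new ∎

    -- The right-hand side of `rookNumber-suc` vanishes by induction, and a sum of natural numbers
    -- that is 0 has zero summands.
    rookNumber-> : ∀ {N} (B : Board N) → IsSingleton m B → ∀ {k} → N < k → rookNumber m k B ≡ 0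
    rookNumber-> {zero}  B S {suc k} _         = refl
    rookNumber-> {suc N} B S {suc k} (s≤s N<k) = m+n≡0⇒m≡0 (rookNumber m (suc k) B) (begin
      rookNumber m (suc k) B + k * m * rookNumber m k (dropLast B)
        ≡⟨ rookNumber-suc B S k ⟩
      rookNumber m (suc k) (dropLast B) + B (fromℕ N) * rookNumber m k (dropLast B)
        ≡⟨ cong₂ (λ x y → x + B (fromℕ N) * y) (rookNumber-> (dropLast B) (dropLast-singleton S) (m<n⇒m<1+n N<k))
                                               (rookNumber-> (dropLast B) (dropLast-singleton S) N<k) ⟩
      B (fromℕ N) * 0
        ≡⟨ *-zeroʳ (B (fromℕ N)) ⟩
      0 ∎)
      where open ≡-Reasoning

open import Data.Integer using (ℤ; +_; 0ℤ; 1ℤ; -1ℤ; _+_; _-_; -_; _*_; _^_)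
open import Data.Integer.Properties using (+-assoc; +-identityˡ; +-identityʳ; *-zeroˡ; *-zeroʳ; pos-+; pos-*)
open import Data.Integer.Tactic.RingSolver using (solve-∀)

-- Elementary symmetric polynomials.

elementary-∷ : ∀ i x xs → elementary (suc i) (x ∷ xs) ≡ x * elementary i xs + elementary (suc i) xs
elementary-∷ i x xs = go (choose i xs)
  where
  go : ∀ ss → sumℤ (map productℤ (map (x ∷_) ss ++ choose (suc i) xs)) ≡
              x * sumℤ (map productℤ ss) + elementary (suc i) xs
  go []       = sym (trans (cong (_+ elementary (suc i) xs) (*-zeroʳ x)) (+-identityˡ _))
  go (s ∷ ss) = trans (cong (λ z → x * productℤ s + z) (go ss)) (regroup x (productℤ s) _ _)
    where
    regroup : ∀ x p t e → x * p + (x * t + e) ≡ x * (p + t) + e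
    regroup = solve-∀

-- Boards grow on the right, whereas `choose` splits off the head; the induction applies
-- `elementary-∷` on both sides.
elementary-∷ʳ : ∀ i xs x → elementary (suc i) (xs ++ [ x ]) ≡ elementary (suc i) xs + x * elementary i xs
elementary-∷ʳ zero    [] x = trans (+-identityʳ (x * 1ℤ)) (sym (+-identityˡ (x * 1ℤ)))
elementary-∷ʳ (suc i) [] x = sym (trans (+-identityˡ (x * 0ℤ)) (*-zeroʳ x))
elementary-∷ʳ zero (y ∷ xs) x = begin
  elementary 1 (y ∷ xs ++ [ x ])                   ≡⟨ elementary-∷ 0 y (xs ++ [ x ]) ⟩
  y * 1ℤ + elementary 1 (xs ++ [ x ])              ≡⟨ cong (λ z → y * 1ℤ + z) (elementary-∷ʳ 0 xs x) ⟩
  y * 1ℤ + (elementary 1 xs + x * 1ℤ)              ≡⟨ +-assoc (y * 1ℤ) _ _ ⟨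
  y * 1ℤ + elementary 1 xs + x * 1ℤ                ≡⟨ cong (_+ x * 1ℤ) (elementary-∷ 0 y xs) ⟨
  elementary 1 (y ∷ xs) + x * 1ℤ                   ∎
  where open ≡-Reasoning
elementary-∷ʳ (suc i) (y ∷ xs) x = begin
  elementary (suc (suc i)) (y ∷ xs ++ [ x ])
    ≡⟨ elementary-∷ (suc i) y (xs ++ [ x ]) ⟩
  y * elementary (suc i) (xs ++ [ x ]) + elementary (suc (suc i)) (xs ++ [ x ])
    ≡⟨ cong₂ (λ a b → y * a + b) (elementary-∷ʳ i xs x) (elementary-∷ʳ (suc i) xs x) ⟩
  y * (e₁ + x * e₀) + (e₂ + x * e₁)
    ≡⟨ regroup x y e₀ e₁ e₂ ⟩
  (y * e₁ + e₂) + x * (y * e₀ + e₁)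
    ≡⟨ cong₂ (λ a b → a + x * b) (elementary-∷ (suc i) y xs) (elementary-∷ i y xs) ⟨
  elementary (suc (suc i)) (y ∷ xs) + x * elementary (suc i) (y ∷ xs) ∎
  where
  open ≡-Reasoning
  e₀ = elementary i xs
  e₁ = elementary (suc i) xs
  e₂ = elementary (suc (suc i)) xs
  regroup : ∀ x y e₀ e₁ e₂ → y * (e₁ + x * e₀) + (e₂ + x * e₁) ≡ (y * e₁ + e₂) + x * (y * e₀ + e₁)
  regroup = solve-∀

elementary-> : ∀ {i} xs → length xs < i → elementary i xs ≡ 0ℤ
elementary-> {suc i} []       _         = refl
elementary-> {suc i} (x ∷ xs) (s≤s l<i) = begin
  elementary (suc i) (x ∷ xs)                   ≡⟨ elementary-∷ i x xs ⟩
  x * elementary i xs + elementary (suc i) xs   ≡⟨ cong₂ (λ a b → x * a + b) (elementary-> xs l<i) (elementary-> xs (ℕ.m<n⇒m<1+n l<i)) ⟩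
  x * 0ℤ + 0ℤ                                   ≡⟨ trans (+-identityʳ (x * 0ℤ)) (*-zeroʳ x) ⟩
  0ℤ                                            ∎
  where open ≡-Reasoning

-- Finite sums of integers.

∑< : ℕ → (ℕ → ℤ) → ℤ
∑< n f = sumℤ (applyUpTo f n)

∑<-cong : ∀ n {f g} → (∀ {i} → i < n → f i ≡ g i) → ∑< n f ≡ ∑< n g
∑<-cong zero    h = refl
∑<-cong (suc n) h = cong₂ _+_ (h (s≤s z≤n)) (∑<-cong n (h ∘ s≤s))

∑<-linear : ∀ n c f g → ∑< n (λ i → f i + c * g i) ≡ ∑< n f + c * ∑< n g
∑<-linear zero    c f g = sym (trans (+-identityˡ (c * 0ℤ)) (*-zeroʳ c))
∑<-linear (suc n) c f g = trans (cong (λ z → f 0 + c * g 0 + z) (∑<-linear n c (f ∘ suc) (g ∘ suc)))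
                                (regroup c (f 0) (g 0) (∑< n (f ∘ suc)) (∑< n (g ∘ suc)))
  where
  regroup : ∀ c a b s t → a + c * b + (s + c * t) ≡ a + s + c * (b + t)
  regroup = solve-∀

∑<-0 : ∀ n → ∑< n (λ _ → 0ℤ) ≡ 0ℤ
∑<-0 zero    = refl
∑<-0 (suc n) = trans (+-identityˡ _) (∑<-0 n)

∑<-suc : ∀ n f → ∑< (suc n) f ≡ ∑< n f + f n
∑<-suc zero    f = trans (+-identityʳ (f 0)) (sym (+-identityˡ (f 0)))
∑<-suc (suc n) f = trans (cong (λ z → f 0 + z) (∑<-suc n (f ∘ suc))) (sym (+-assoc (f 0) _ _))

-- The right-hand side and its recurrences.

module _ (m : ℕ) where

  -- `N` is independent of the length of the list, because the two recurrences below change the list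
  -- and the Stirling indices separately.
  expansionTerm : (N k : ℕ) → List ℤ → ℕ → ℤ
  expansionTerm N k xs i = -1ℤ ^ i * (+ m) ^ (k ∸ i) * + stirling₂ (N ∸ i) (N ∸ k) * elementary i xs

  expansion : (N k : ℕ) → List ℤ → ℤ
  expansion N k xs = ∑< (suc k) (expansionTerm N k xs)

  expansion-0 : ∀ N xs → expansion N 0 xs ≡ 1ℤ
  expansion-0 N xs rewrite stirling₂-diagonal N = refl

  -- The term i = 0 does not see the list. In the term i + 1, the part of `elementary-∷ʳ` with the
  -- factor `x` has the indices of the term i for N and k, and the extra sign turns `x` into `- x`.
  expansion-∷ʳ : ∀ N k xs x → expansion (suc N) (suc k) (xs ++ [ x ]) ≡
                 expansion (suc N) (suc k) xs + - x * expansion N k xs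
  expansion-∷ʳ N k xs x = begin
    t 0 + ∑< (suc k) (expansionTerm (suc N) (suc k) (xs ++ [ x ]) ∘ suc)
      ≡⟨ cong (λ z → t 0 + z) (∑<-cong (suc k) (λ {i} _ → term i)) ⟩
    t 0 + ∑< (suc k) (λ i → t (suc i) + - x * expansionTerm N k xs i)
      ≡⟨ cong (λ z → t 0 + z) (∑<-linear (suc k) (- x) (t ∘ suc) (expansionTerm N k xs)) ⟩
    t 0 + (∑< (suc k) (t ∘ suc) + - x * expansion N k xs)
      ≡⟨ +-assoc (t 0) _ _ ⟨
    expansion (suc N) (suc k) xs + - x * expansion N k xs ∎
    where
    open ≡-Reasoning
    t = expansionTerm (suc N) (suc k) xs
    regroup : ∀ a b c x e₀ e₁ → -1ℤ * a * b * c * (e₁ + x * e₀) ≡ -1ℤ * a * b * c * e₁ + - x * (a * b * c * e₀)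
    regroup = solve-∀
    term : ∀ i → expansionTerm (suc N) (suc k) (xs ++ [ x ]) (suc i) ≡ t (suc i) + - x * expansionTerm N k xs i
    term i = trans (cong (-1ℤ ^ suc i * (+ m) ^ (k ∸ i) * + stirling₂ (N ∸ i) (N ∸ k) *_) (elementary-∷ʳ i xs x))
      (regroup (-1ℤ ^ i) ((+ m) ^ (k ∸ i)) (+ stirling₂ (N ∸ i) (N ∸ k)) x (elementary i xs) (elementary (suc i) xs))

  -- The Stirling recurrence is applied in each term. The assumption k < N makes both indices
  -- successors, with N - k blocks.
  expansion-suc : ∀ {N k} xs → k < N → expansion (suc N) (suc k) xs ≡
                  expansion N (suc k) xs + + m * + (N ∸ k) * expansion N k xs
  expansion-suc {N} {k} xs k<N = begin
    expansion (suc N) (suc k) xs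
      ≡⟨ ∑<-cong (suc (suc k)) split ⟩
    ∑< (suc (suc k)) (λ i → expansionTerm N (suc k) xs i + + (N ∸ k) * lower i)
      ≡⟨ ∑<-linear (suc (suc k)) (+ (N ∸ k)) (expansionTerm N (suc k) xs) lower ⟩
    expansion N (suc k) xs + + (N ∸ k) * ∑< (suc (suc k)) lower
      ≡⟨ cong (λ z → expansion N (suc k) xs + + (N ∸ k) * z) ∑-lower ⟩
    expansion N (suc k) xs + + (N ∸ k) * (+ m * expansion N k xs)
      ≡⟨ cong (λ z → expansion N (suc k) xs + z) (exchange (+ (N ∸ k)) (+ m) (expansion N k xs)) ⟩
    expansion N (suc k) xs + + m * + (N ∸ k) * expansion N k xs ∎
    where
    open ≡-Reasoning
    exchange : ∀ a b c → a * (b * c) ≡ b * a * c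
    exchange = solve-∀
    N∸k : N ∸ k ≡ suc (N ∸ suc k)
    N∸k = ℕ.+-∸-assoc 1 k<N
    -- The exponent is still `suc k ∸ i`, so for i ≤ k a factor `m` splits off and a term of
    -- `expansion N k xs` remains.
    lower : ℕ → ℤ
    lower i = -1ℤ ^ i * (+ m) ^ (suc k ∸ i) * + stirling₂ (N ∸ i) (N ∸ k) * elementary i xs

    stirling-split : ∀ {i} → i < suc (suc k) → + stirling₂ (suc N ∸ i) (N ∸ k) ≡
                     + stirling₂ (N ∸ i) (N ∸ suc k) + + (N ∸ k) * + stirling₂ (N ∸ i) (N ∸ k)
    stirling-split {i} (s≤s i≤k+1)
      rewrite N∸k | ℕ.+-∸-assoc 1 (ℕ.≤-trans i≤k+1 k<N) | stirling₂-suc (N ∸ i) (N ∸ suc k)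
      = trans (pos-+ (stirling₂ (N ∸ i) (N ∸ suc k)) _)
              (cong (λ z → + stirling₂ (N ∸ i) (N ∸ suc k) + z) (pos-* (suc (N ∸ suc k)) _))

    regroup : ∀ a b c d s e → a * b * (c + d * s) * e ≡ a * b * c * e + d * (a * b * s * e)
    regroup = solve-∀
    split : ∀ {i} → i < suc (suc k) →
            expansionTerm (suc N) (suc k) xs i ≡ expansionTerm N (suc k) xs i + + (N ∸ k) * lower i
    split {i} i< = trans
      (cong (λ z → -1ℤ ^ i * (+ m) ^ (suc k ∸ i) * z * elementary i xs) (stirling-split i<))
      (regroup (-1ℤ ^ i) ((+ m) ^ (suc k ∸ i)) _ (+ (N ∸ k)) (+ stirling₂ (N ∸ i) (N ∸ k)) (elementary i xs))

    -- The surplus term contains S(N - k - 1, N - k), with more blocks than elements.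
    last : lower (suc k) ≡ 0ℤ
    last rewrite stirling₂-< {N ∸ suc k} {N ∸ k} (ℕ.≤-reflexive (sym N∸k))
      = trans (cong (_* elementary (suc k) xs) (*-zeroʳ (-1ℤ ^ suc k * (+ m) ^ (k ∸ k)))) (*-zeroˡ (elementary (suc k) xs))

    scale : ∀ {i} → i < suc k → lower i ≡ 0ℤ + + m * expansionTerm N k xs i
    scale {i} (s≤s i≤k) rewrite ℕ.+-∸-assoc 1 i≤k =
      pull (-1ℤ ^ i) (+ m) ((+ m) ^ (k ∸ i)) (+ stirling₂ (N ∸ i) (N ∸ k)) (elementary i xs)
      where
      pull : ∀ a m p s e → a * (m * p) * s * e ≡ 0ℤ + m * (a * p * s * e)
      pull = solve-∀

    ∑-lower : ∑< (suc (suc k)) lower ≡ + m * expansion N k xs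
    ∑-lower = begin
      ∑< (suc (suc k)) lower
        ≡⟨ ∑<-suc (suc k) lower ⟩
      ∑< (suc k) lower + lower (suc k)
        ≡⟨ cong₂ _+_ (∑<-cong (suc k) scale) last ⟩
      ∑< (suc k) (λ i → 0ℤ + + m * expansionTerm N k xs i) + 0ℤ
        ≡⟨ +-identityʳ _ ⟩
      ∑< (suc k) (λ i → 0ℤ + + m * expansionTerm N k xs i)
        ≡⟨ ∑<-linear (suc k) (+ m) (λ _ → 0ℤ) (expansionTerm N k xs) ⟩
      ∑< (suc k) (λ _ → 0ℤ) + + m * expansion N k xs
        ≡⟨ cong (_+ + m * expansion N k xs) (∑<-0 (suc k)) ⟩
      0ℤ + + m * expansion N k xs
        ≡⟨ +-identityˡ _ ⟩
      + m * expansion N k xs ∎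

  -- Terms with i ≤ N contain S(N + 1 - i, 0), which is 0 since N + 1 - i is positive. The term i =
  -- N + 1 contains an elementary symmetric polynomial of degree N + 1 in N entries.
  expansion-top : ∀ {N} xs → length xs ≡ N → expansion (suc N) (suc N) xs ≡ 0ℤ
  expansion-top {N} xs refl = trans (∑<-suc (suc N) t)
    (cong₂ _+_ (trans (∑<-cong (suc N) early) (∑<-0 (suc N))) last)
    where
    t = expansionTerm (suc N) (suc N) xs
    early : ∀ {i} → i < suc N → t i ≡ 0ℤ
    early {i} (s≤s i≤N) rewrite ℕ.+-∸-assoc 1 i≤N | ℕ.n∸n≡0 N =
      trans (cong (_* elementary i xs) (*-zeroʳ (-1ℤ ^ i * (+ m) ^ suc (N ∸ i)))) (*-zeroˡ (elementary i xs))
    last : t (suc N) ≡ 0ℤ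
    last = trans (cong (c *_) (elementary-> xs (ℕ.n<1+n N))) (*-zeroʳ c)
      where c = -1ℤ ^ suc N * (+ m) ^ (N ∸ N) * + stirling₂ (N ∸ N) (N ∸ N)

-- Comparison of the two sides.

deficits : ∀ m {N} → Board N → List ℤ
deficits m {N} B = tabulate (λ j → + Δ N m j - + B j)

deficits-dropLast : ∀ m {N} (B : Board (suc N)) →
                    deficits m B ≡ deficits m (dropLast B) ++ [ + (N ℕ.* m) - + B (fromℕ N) ]
deficits-dropLast m {N} B = trans (tabulate-∷ʳ (λ j → + Δ (suc N) m j - + B j)) (cong₂ _++_
  (tabulate-cong (λ j → cong (λ i → + (i ℕ.* m) - + B (inject₁ j)) (toℕ-inject₁ j)))
  (cong (λ i → [ + (i ℕ.* m) - + B (fromℕ N) ]) (toℕ-fromℕ N)))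

-- Induction on the number of columns. The range includes k = N, because the recurrence for k + 1
-- rooks on N + 1 columns refers to k + 1 rooks on N columns, where k + 1 may equal N.
rookNumber-expansion : ∀ m .{{_ : NonZero m}} {N} (B : Board N) → IsSingleton m B →
                       ∀ {k} → k ≤ N → + rookNumber m k B ≡ expansion m N k (deficits m B)
rookNumber-expansion m {N} B S {zero} _ = sym (expansion-0 m N (deficits m B))
rookNumber-expansion m {suc N} B S {suc k} (s≤s k≤N) = begin
  + R
    ≡⟨ cancel (+ R) (+ k * + m * + r) ⟩
  (+ R + + k * + m * + r) - + k * + m * + r
    ≡⟨ cong (_- + k * + m * + r) recurrence ⟩
  (+ r′ + + H * + r) - + k * + m * + r
    -- The factor H - k m is written as m (N - k) - (N m - H): the first part belongs to the
    -- Stirling recurrence, the second to the new entry `x`.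
    ≡⟨ regroup (+ k) (+ (N ∸ k)) (+ m) (+ H) (+ r) (+ r′) ⟩
  (+ r′ + + m * + (N ∸ k) * + r) + - ((+ k + + (N ∸ k)) * + m - + H) * + r
    ≡⟨ cong (λ z → (+ r′ + + m * + (N ∸ k) * + r) + - (z - + H) * + r) N*m ⟩
  (+ r′ + + m * + (N ∸ k) * + r) + - x * + r
    ≡⟨ cong₂ (λ a b → a + - x * b) (step (ℕ.m≤n⇒m<n∨m≡n k≤N)) IH ⟩
  expansion m (suc N) (suc k) xs + - x * expansion m N k xs
    ≡⟨ expansion-∷ʳ m N k xs x ⟨
  expansion m (suc N) (suc k) (xs ++ [ x ])
    ≡⟨ cong (expansion m (suc N) (suc k)) (deficits-dropLast m B) ⟨
  expansion m (suc N) (suc k) (deficits m B) ∎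
  where
  open ≡-Reasoning
  B′ = dropLast B
  S′ = dropLast-singleton m S
  H = B (fromℕ N)
  R = rookNumber m (suc k) B
  r = rookNumber m k B′
  r′ = rookNumber m (suc k) B′
  xs = deficits m B′
  x = + (N ℕ.* m) - + H
  IH : + r ≡ expansion m N k xs
  IH = rookNumber-expansion m B′ S′ k≤N

  cancel : ∀ a b → a ≡ (a + b) - b
  cancel = solve-∀
  regroup : ∀ k d m h r r′ → (r′ + h * r) - k * m * r ≡ (r′ + m * d * r) + - ((k + d) * m - h) * r
  regroup = solve-∀

  recurrence : + R + + k * + m * + r ≡ + r′ + + H * + r
  recurrence = begin
    + R + + k * + m * + r        ≡⟨ cong (λ z → + R + z * + r) (pos-* k m) ⟨
    + R + + (k ℕ.* m) * + r      ≡⟨ cong (λ z → + R + z) (pos-* (k ℕ.* m) r) ⟨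
    + (R ℕ.+ k ℕ.* m ℕ.* r)      ≡⟨ cong +_ (rookNumber-suc m B S k) ⟩
    + (r′ ℕ.+ H ℕ.* r)           ≡⟨ cong (λ z → + r′ + z) (pos-* H r) ⟩
    + r′ + + H * + r             ∎

  N*m : (+ k + + (N ∸ k)) * + m ≡ + (N ℕ.* m)
  N*m = trans (cong (λ n → + n * + m) (ℕ.m+[n∸m]≡n k≤N)) (sym (pos-* N m))

  -- For k < N this is `expansion-suc` with the induction hypothesis. For k = N there are more rooks
  -- than columns and the factor N - k is 0, in agreement with `expansion-top`.
  step : k < N ⊎ k ≡ N → + r′ + + m * + (N ∸ k) * + r ≡ expansion m (suc N) (suc k) xs
  step (inj₁ k<N) = trans
    (cong₂ (λ a b → a + + m * + (N ∸ k) * b) (rookNumber-expansion m B′ S′ k<N) IH)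
    (sym (expansion-suc m xs k<N))
  step (inj₂ refl) = begin
    + r′ + + m * + (N ∸ N) * + r
      ≡⟨ cong₂ (λ a b → + a + + m * + b * + r) (rookNumber-> m B′ S′ (ℕ.n<1+n N)) (ℕ.n∸n≡0 N) ⟩
    0ℤ + + m * 0ℤ * + r
      ≡⟨ trans (+-identityˡ _) (cong (_* + r) (*-zeroʳ (+ m))) ⟩
    0ℤ
      ≡⟨ expansion-top m {N} xs (length-tabulate (λ j → + Δ N m j - + B′ j)) ⟨
    expansion m (suc N) (suc N) xs ∎

theorem20 : (m : ℕ) .{{_ : NonZero m}} (N : ℕ) (B : Board N) →
    IsSingleton m B → FitsInside B (Δ N m) →
    (k : ℕ) → k < N →
    + rookNumber m k B ≡
      sumℤ (map (λ i → -1ℤ ^ i * (+ m) ^ (k ∸ i)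
                        * + stirling₂ (N ∸ i) (N ∸ k)
                        * elementary i (tabulate (λ j → + Δ N m j - + B j)))
                (upTo (suc k)))
theorem20 m N B S _ k k<N = trans (rookNumber-expansion m B S (ℕ.<⇒≤ k<N))
  (cong sumℤ (sym (map-upTo (expansionTerm m N k (deficits m B)) (suc k))))
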